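{- Let $k\ge 2$ and let $G_1$ and $G_2$ be two $H$-consistent graphs. Then $\mathsf{TS}_k(H(G_1,G_2))$ is the union of $\mathsf{TS}_k(G_1)$, $\mathsf{TS}_k(G_2)$ and, for every pair of $k$-element independent sets $S_1$ in $G_1$ and $S_2$ in $G_2$ satisfying $$|S_1\cap V(H)|=|S_2\cap V(H)|=|S_1\cap S_2|=k-1,$$ the edge between $S_1$ and $S_2$.
   Context: Graphs are finite, simple, undirected and vertex-labelled (vertices are identified by their labels). For a graph $G$ and an integer $k\ge 2$, $\mathsf{TS}_k(G)$ is the graph whose nodes are all size-$k$ independent sets of $G$, two nodes $I,J$ being adjacent if there are vertices $u,v$ of $G$ with $I\setminus J=\{u\}$, $J\setminus I=\{v\}$ and $uv\in E(G)$. The union of two labelled graphs has as vertex set (edge set) the union of the vertex sets (edge sets). Graphs $G_1,G_2$ are $H$-consistent if the (possibly empty) set $V(G_1)\cap V(G_2)$ induces the same (possibly empty) subgraph $H$ in both $G_1$ and $G_2$. The $H$-join of $H$-consistent graphs $G_1,G_2$ is the graph $H(G_1,G_2)$ with vertex set $V(G_1)\cup V(G_2)$ and edge set consisting of $E(G_1)\cup E(G_2)$ together with all edges $vw$ with $v\in V(G_1)\setminus V(H)$ and $w\in V(G_2)\setminus V(H)$. -}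

module Defs where

open import Data.Bool.Properties using () renaming (_≟_ to _≟ᵇ_)
open import Data.Fin.Base using (Fin)
open import Data.Fin.Properties using (any?; all?)
open import Data.Fin.Subset using (Subset; ∣_∣; ⁅_⁆) renaming (_∈_ to _∈ˢ_; _∩_ to _∩ˢ_; _─_ to _─ˢ_)
open import Data.Fin.Subset.Properties using (_∈?_; anySubset?; x∈⁅x⁆; x∈⁅y⁆⇒x≡y; ∩-idem)
open import Data.Nat.Base using (ℕ; suc; _∸_; _≤_)
open import Data.Nat.Properties using (_≟_; 1+n≢n)
open import Data.Product.Base using (_×_; _,_; ∃; proj₁)
open import Data.Sum.Base as Sum using (_⊎_; inj₁; inj₂; [_,_]′)
open import Data.Vec.Base using (tabulate)
open import Data.Vec.Properties using (≡-dec)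
open import Function.Base using (_∘_)
open import Level using (0ℓ)
open import Relation.Binary.Core using (Rel; _⇔_)
open import Relation.Binary.Definitions using (DecidableEquality; Symmetric) renaming (Decidable to Decidable₂)
open import Relation.Binary.PropositionalEquality using (_≡_; sym; trans; cong; subst)
open import Relation.Nullary.Decidable using (does; _×-dec_; _⊎-dec_; _→-dec_; ¬?)
open import Relation.Nullary.Negation using (¬_)
open import Relation.Unary using (Pred; Decidable; _≐_; _∩_; _∪_)

-- Simple undirected graphs whose vertices are labels drawn from L.  Below, L is
-- either Fin n (a pool of n labels, shared by all the graphs considered) or
-- Subset n (for token sliding graphs), so these graphs are finite; decidability
-- of the vertex and edge sets is part of what finiteness means.
record Graph (L : Set) : Set₁ where
  field
    V        : Pred L 0ℓ
    E        : Rel L 0ℓ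
    V?       : Decidable V
    E?       : Decidable₂ E
    E-sym    : Symmetric E
    E-irrefl : ∀ {x} → ¬ E x x
    E⇒V      : ∀ {x y} → E x y → V x

open Graph public

private
  variable
    L : Set
    n : ℕ

-- Equality (not isomorphism) of labelled graphs.
infix 4 _≈_
_≈_ : Graph L → Graph L → Set
G ≈ G′ = (V G ≐ V G′) × (E G ⇔ E G′)

infixr 6 _⊔_
_⊔_ : Graph L → Graph L → Graph L
G₁ ⊔ G₂ = record
  { V        = V G₁ ∪ V G₂
  ; E        = λ x y → E G₁ x y ⊎ E G₂ x y
  ; V?       = λ x → V? G₁ x ⊎-dec V? G₂ x
  ; E?       = λ x y → E? G₁ x y ⊎-dec E? G₂ x y
  ; E-sym    = Sum.map (E-sym G₁) (E-sym G₂)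
  ; E-irrefl = [ E-irrefl G₁ , E-irrefl G₂ ]′
  ; E⇒V      = Sum.map (E⇒V G₁) (E⇒V G₂)
  }

induced : (G : Graph L) (P : Pred L 0ℓ) → Decidable P → Graph L
induced G P P? = record
  { V        = V G ∩ P
  ; E        = λ x y → E G x y × P x × P y
  ; V?       = λ x → V? G x ×-dec P? x
  ; E?       = λ x y → E? G x y ×-dec P? x ×-dec P? y
  ; E-sym    = λ (e , px , py) → E-sym G e , py , px
  ; E-irrefl = E-irrefl G ∘ proj₁
  ; E⇒V      = λ (e , px , _) → E⇒V G e , px
  }

Consistent : (H G₁ G₂ : Graph L) → Set
Consistent H G₁ G₂ =
  induced G₁ (V G₁ ∩ V G₂) common? ≈ H × induced G₂ (V G₁ ∩ V G₂) common? ≈ H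
  where
  common? : Decidable (V G₁ ∩ V G₂)
  common? x = V? G₁ x ×-dec V? G₂ x

Cross : (H G₁ G₂ : Graph L) → Rel L 0ℓ
Cross H G₁ G₂ v w = (V G₁ v × ¬ V H v) × (V G₂ w × ¬ V H w)

-- Consistency is needed only to exclude loops: it makes V(G₁) ∖ V(H) and
-- V(G₂) ∖ V(H) disjoint.
join : (H G₁ G₂ : Graph L) → Consistent H G₁ G₂ → Graph L
join {L} H G₁ G₂ ((V≐ , _) , _) = record
  { V        = V G₁ ∪ V G₂
  ; E        = λ x y → E G₁ x y ⊎ E G₂ x y ⊎ X x y ⊎ X y x
  ; V?       = λ x → V? G₁ x ⊎-dec V? G₂ x
  ; E?       = λ x y → E? G₁ x y ⊎-dec E? G₂ x y ⊎-dec X? x y ⊎-dec X? y x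
  ; E-sym    = Sum.map (E-sym G₁) (Sum.map (E-sym G₂) Sum.swap)
  ; E-irrefl = [ E-irrefl G₁ , [ E-irrefl G₂ , [ X-irrefl , X-irrefl ]′ ]′ ]′
  ; E⇒V      = λ where
      (inj₁ e)                                  → inj₁ (E⇒V G₁ e)
      (inj₂ (inj₁ e))                           → inj₂ (E⇒V G₂ e)
      (inj₂ (inj₂ (inj₁ ((x∈ , _) , _))))       → inj₁ x∈
      (inj₂ (inj₂ (inj₂ (_ , (x∈ , _)))))       → inj₂ x∈
  }
  where
  X : Rel L 0ℓ
  X = Cross H G₁ G₂

  X? : Decidable₂ X
  X? v w = (V? G₁ v ×-dec ¬? (V? H v)) ×-dec (V? G₂ w ×-dec ¬? (V? H w))

  X-irrefl : ∀ {x} → ¬ X x x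
  X-irrefl ((x∈₁ , x∉H) , (x∈₂ , _)) = x∉H (proj₁ V≐ (x∈₁ , x∈₁ , x∈₂))

_≟ˢ_ : DecidableEquality (Subset n)
_≟ˢ_ = ≡-dec _≟ᵇ_

vertexSet : Graph (Fin n) → Subset n
vertexSet G = tabulate (does ∘ V? G)

Independent : Graph (Fin n) → Pred (Subset n) 0ℓ
Independent G S = (∀ u → u ∈ˢ S → V G u) × (∀ u v → u ∈ˢ S → v ∈ˢ S → ¬ E G u v)

IndependentOfSize : ℕ → Graph (Fin n) → Pred (Subset n) 0ℓ
IndependentOfSize k G S = ∣ S ∣ ≡ k × Independent G S

independentOfSize? : (k : ℕ) (G : Graph (Fin n)) → Decidable (IndependentOfSize k G)
independentOfSize? k G S =
  (∣ S ∣ ≟ k) ×-dec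
  all? (λ u → (u ∈? S) →-dec V? G u) ×-dec
  all? (λ u → all? (λ v → (u ∈? S) →-dec (v ∈? S) →-dec ¬? (E? G u v)))

Slide : Graph (Fin n) → Rel (Subset n) 0ℓ
Slide G I J = ∃ λ u → ∃ λ v → I ─ˢ J ≡ ⁅ u ⁆ × J ─ˢ I ≡ ⁅ v ⁆ × E G u v

TS : ℕ → Graph (Fin n) → Graph (Subset n)
TS {n} k G = record
  { V        = IndependentOfSize k G
  ; E        = λ I J → IndependentOfSize k G I × IndependentOfSize k G J × Slide G I J
  ; V?       = independentOfSize? k G
  ; E?       = λ I J → independentOfSize? k G I ×-dec independentOfSize? k G J ×-dec slide? I J
  ; E-sym    = λ (i , j , u , v , p , q , e) → j , i , v , u , q , p , E-sym G e
  ; E-irrefl = λ (_ , _ , u , v , p , q , e) →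
      E-irrefl G (subst (E G u) (sym (singletons u v (trans (sym p) q))) e)
  ; E⇒V      = proj₁
  }
  where
  slide? : Decidable₂ (Slide G)
  slide? I J = any? λ u → any? λ v →
    ((I ─ˢ J) ≟ˢ ⁅ u ⁆) ×-dec ((J ─ˢ I) ≟ˢ ⁅ v ⁆) ×-dec E? G u v

  singletons : (u v : Fin n) → ⁅ u ⁆ ≡ ⁅ v ⁆ → u ≡ v
  singletons u v eq = x∈⁅y⁆⇒x≡y v (subst (u ∈ˢ_) eq (x∈⁅x⁆ u))

Linked : ℕ → (H G₁ G₂ : Graph (Fin n)) → Rel (Subset n) 0ℓ
Linked k H G₁ G₂ S₁ S₂ =
  IndependentOfSize k G₁ S₁ × IndependentOfSize k G₂ S₂ ×
  ∣ S₁ ∩ˢ vertexSet H ∣ ≡ k ∸ 1 ×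
  ∣ S₂ ∩ˢ vertexSet H ∣ ≡ k ∸ 1 ×
  ∣ S₁ ∩ˢ S₂ ∣ ≡ k ∸ 1

-- The graph formed by the edges S₁S₂ with S₁ and S₂ linked, together with their
-- endpoints.  (For k = 0 truncated subtraction would produce a loop at ∅.)
linkEdges : (k : ℕ) → 2 ≤ k → (H G₁ G₂ : Graph (Fin n)) → Graph (Subset n)
linkEdges {n} (suc k) _ H G₁ G₂ = record
  { V        = λ S → ∃ λ T → R S T ⊎ R T S
  ; E        = λ S T → R S T ⊎ R T S
  ; V?       = λ S → anySubset? (λ T → R? S T ⊎-dec R? T S)
  ; E?       = λ S T → R? S T ⊎-dec R? T S
  ; E-sym    = Sum.swap
  ; E-irrefl = [ R-irrefl , R-irrefl ]′
  ; E⇒V      = λ {_} {T} r → T , r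
  }
  where
  R : Rel (Subset n) 0ℓ
  R = Linked (suc k) H G₁ G₂

  R? : Decidable₂ R
  R? S T =
    independentOfSize? (suc k) G₁ S ×-dec independentOfSize? (suc k) G₂ T ×-dec
    (∣ S ∩ˢ vertexSet H ∣ ≟ k) ×-dec (∣ T ∩ˢ vertexSet H ∣ ≟ k) ×-dec (∣ S ∩ˢ T ∣ ≟ k)

  R-irrefl : ∀ {S} → ¬ R S S
  R-irrefl {S} ((∣S∣≡1+k , _) , _ , _ , _ , ∣S∩S∣≡k) =
    1+n≢n (trans (sym ∣S∣≡1+k) (trans (cong ∣_∣ (sym (∩-idem S))) ∣S∩S∣≡k))

{-# OPTIONS --safe #-}

-- Since V(H) = V(G₁) ∩ V(G₂), both Gᵢ are induced subgraphs of the join K, and an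
-- independent set of K cannot meet both V(G₁) ∖ V(H) and V(G₂) ∖ V(H); hence it is
-- an independent set of G₁ or of G₂.  A slide of K from u to v with ends in G₁ and
-- G₂ takes place in one of the Gᵢ, unless u ∉ V(G₂) and v ∉ V(G₁).  In that case
-- the k − 1 tokens that stay are exactly the tokens on V(H).  Conversely, for
-- linked S₁ and S₂ each Sᵢ ∩ V(H) contains S₁ ∩ S₂ and has the same size, so
-- the remaining token of each Sᵢ lies outside V(H), and the join provides the edge
-- along which it slides.
module Submission where

open import Defs
open import Data.Nat.Base using (ℕ; suc; _+_; _∸_; _≤_)
open import Data.Fin.Base using (Fin; zero; suc)
open import Data.Bool.Base using (true)
open import Data.Fin.Properties using (any?)
open import Data.Fin.Subset using (Subset; inside; outside; ∣_∣; ⁅_⁆; ⊥) renaming (_∈_ to _∈ˢ_; _∉_ to _∉ˢ_; _⊆_ to _⊆ˢ_; _∩_ to _∩ˢ_; _─_ to _─ˢ_)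
open import Data.Fin.Subset.Properties using (_∈?_; ⊆-antisym; p⊂q⇒∣p∣<∣q∣; x∈⁅x⁆; x∈⁅y⁆⇒x≡y; ∣⁅x⁆∣≡1; p─q⊆p; x∈p∧x∉q⇒x∈p─q; x∈p∩q⁺; x∈p∩q⁻; ∩-comm)
open import Data.Nat.Properties using (+-suc; +-cancelˡ-≡; +-comm; m+n∸n≡m; <-irrefl; suc-injective)
open import Data.Product.Base as Product using (_×_; _,_; ∃; proj₁; proj₂; swap)
open import Data.Sum.Base as Sum using (_⊎_; inj₁; inj₂; [_,_]′)
open import Data.Vec.Base using ([]; _∷_; here; there)
open import Data.Vec.Properties using ([]=⇒lookup; lookup⇒[]=; lookup∘tabulate)
open import Function.Base using (_∘_; id)
open import Level using (0ℓ)
open import Relation.Binary.PropositionalEquality using (_≡_; refl; sym; trans; cong; subst; module ≡-Reasoning)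
open import Relation.Nullary.Decidable using (Dec; yes; no; does; dec-true; decidable-stable; _×-dec_; ¬?)
open import Relation.Nullary.Negation using (¬_; contradiction)
open import Relation.Unary using (Pred; _≐_; _∩_)

private
  variable
    n k : ℕ

-- Intersections and differences of finite subsets.

∣p∩q∣+∣p─q∣≡∣p∣ : (p q : Subset n) → ∣ p ∩ˢ q ∣ + ∣ p ─ˢ q ∣ ≡ ∣ p ∣
∣p∩q∣+∣p─q∣≡∣p∣ []            []            = refl
∣p∩q∣+∣p─q∣≡∣p∣ (inside  ∷ p) (inside  ∷ q) = cong suc (∣p∩q∣+∣p─q∣≡∣p∣ p q)
∣p∩q∣+∣p─q∣≡∣p∣ (inside  ∷ p) (outside ∷ q) = trans (+-suc _ _) (cong suc (∣p∩q∣+∣p─q∣≡∣p∣ p q))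
∣p∩q∣+∣p─q∣≡∣p∣ (outside ∷ p) (inside  ∷ q) = ∣p∩q∣+∣p─q∣≡∣p∣ p q
∣p∩q∣+∣p─q∣≡∣p∣ (outside ∷ p) (outside ∷ q) = ∣p∩q∣+∣p─q∣≡∣p∣ p q

x∈p─q⇒x∉q : {x : Fin n} (p q : Subset n) → x ∈ˢ p ─ˢ q → x ∉ˢ q
x∈p─q⇒x∉q (_ ∷ p) (inside  ∷ q) ()         here
x∈p─q⇒x∉q (_ ∷ p) (_       ∷ q) (there x∈) (there x∈q) = x∈p─q⇒x∉q p q x∈ x∈q

p⊆q∧∣p∣≡∣q∣⇒q⊆p : {p q : Subset n} → p ⊆ˢ q → ∣ p ∣ ≡ ∣ q ∣ → q ⊆ˢ p
p⊆q∧∣p∣≡∣q∣⇒q⊆p {p = p} p⊆q ∣p∣≡∣q∣ {x} x∈q = decidable-stable (x ∈? p) λ x∉p →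
  <-irrefl ∣p∣≡∣q∣ (p⊂q⇒∣p∣<∣q∣ (p⊆q , x , x∈q , x∉p))

∣p∣≡0⇒p≡⊥ : (p : Subset n) → ∣ p ∣ ≡ 0 → p ≡ ⊥
∣p∣≡0⇒p≡⊥ []            _  = refl
∣p∣≡0⇒p≡⊥ (outside ∷ p) eq = cong (outside ∷_) (∣p∣≡0⇒p≡⊥ p eq)

∣p∣≡1⇒p≡⁅x⁆ : (p : Subset n) → ∣ p ∣ ≡ 1 → ∃ λ x → p ≡ ⁅ x ⁆
∣p∣≡1⇒p≡⁅x⁆ (inside  ∷ p) eq = zero , cong (inside ∷_) (∣p∣≡0⇒p≡⊥ p (suc-injective eq))
∣p∣≡1⇒p≡⁅x⁆ (outside ∷ p) eq = Product.map suc (cong (outside ∷_)) (∣p∣≡1⇒p≡⁅x⁆ p eq)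

module _ {p q : Subset n} {u : Fin n} (p─q≡⁅u⁆ : p ─ˢ q ≡ ⁅ u ⁆) where

  private
    u∈p─q : u ∈ˢ p ─ˢ q
    u∈p─q = subst (u ∈ˢ_) (sym p─q≡⁅u⁆) (x∈⁅x⁆ u)

  p─q≡⁅u⁆⇒u∈p : u ∈ˢ p
  p─q≡⁅u⁆⇒u∈p = p─q⊆p p q u∈p─q

  p─q≡⁅u⁆⇒u∉q : u ∉ˢ q
  p─q≡⁅u⁆⇒u∉q = x∈p─q⇒x∉q p q u∈p─q

  p─q≡⁅u⁆⇒x∈q⊎x≡u : ∀ {x} → x ∈ˢ p → x ∈ˢ q ⊎ x ≡ u
  p─q≡⁅u⁆⇒x∈q⊎x≡u {x} x∈p with x ∈? q
  ... | yes x∈q = inj₁ x∈q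
  ... | no  x∉q = inj₂ (x∈⁅y⁆⇒x≡y u (subst (x ∈ˢ_) p─q≡⁅u⁆ (x∈p∧x∉q⇒x∈p─q x∈p x∉q)))

  -- Phrased with truncated subtraction to match the sizes `k ∸ 1` in `Linked`.
  p─q≡⁅u⁆⇒∣p∩q∣≡∣p∣∸1 : ∣ p ∩ˢ q ∣ ≡ ∣ p ∣ ∸ 1
  p─q≡⁅u⁆⇒∣p∩q∣≡∣p∣∸1 = begin
    ∣ p ∩ˢ q ∣                     ≡⟨ m+n∸n≡m _ 1 ⟨
    ∣ p ∩ˢ q ∣ + 1 ∸ 1             ≡⟨ cong (λ m → ∣ p ∩ˢ q ∣ + m ∸ 1) (trans (cong ∣_∣ p─q≡⁅u⁆) (∣⁅x⁆∣≡1 u)) ⟨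
    ∣ p ∩ˢ q ∣ + ∣ p ─ˢ q ∣ ∸ 1    ≡⟨ cong (_∸ 1) (∣p∩q∣+∣p─q∣≡∣p∣ p q) ⟩
    ∣ p ∣ ∸ 1                      ∎
    where open ≡-Reasoning

∣p∩q∣≡k⇒p─q≡⁅x⁆ : (p q : Subset n) → ∣ p ∣ ≡ suc k → ∣ p ∩ˢ q ∣ ≡ k → ∃ λ x → p ─ˢ q ≡ ⁅ x ⁆
∣p∩q∣≡k⇒p─q≡⁅x⁆ {k = k} p q ∣p∣≡1+k ∣p∩q∣≡k = ∣p∣≡1⇒p≡⁅x⁆ (p ─ˢ q) (+-cancelˡ-≡ k _ _ (begin
  k + ∣ p ─ˢ q ∣             ≡⟨ cong (_+ ∣ p ─ˢ q ∣) ∣p∩q∣≡k ⟨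
  ∣ p ∩ˢ q ∣ + ∣ p ─ˢ q ∣    ≡⟨ ∣p∩q∣+∣p─q∣≡∣p∣ p q ⟩
  ∣ p ∣                      ≡⟨ ∣p∣≡1+k ⟩
  suc k                      ≡⟨ +-comm 1 k ⟩
  k + 1                      ∎))
  where open ≡-Reasoning

∈-vertexSet⁺ : (G : Graph (Fin n)) {x : Fin n} → V G x → x ∈ˢ vertexSet G
∈-vertexSet⁺ G {x} x∈ = lookup⇒[]= x _ (trans (lookup∘tabulate _ x) (dec-true (V? G x) x∈))

∈-vertexSet⁻ : (G : Graph (Fin n)) {x : Fin n} → x ∈ˢ vertexSet G → V G x
∈-vertexSet⁻ G {x} x∈ = does-true (V? G x) (trans (sym (lookup∘tabulate _ x)) ([]=⇒lookup x∈))
  where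
  does-true : {A : Set} (a? : Dec A) → does a? ≡ true → A
  does-true (yes a) _ = a

-- Independent sets and slides in induced subgraphs.

_within_ : Subset n → Pred (Fin n) 0ℓ → Set
S within P = ∀ u → u ∈ˢ S → P u

-- `v` is the only token of `J` not already in `I`. This serves to place both ends of a slide in the
-- same graph.
slide-within : {P : Pred (Fin n) 0ℓ} {I J : Subset n} {v : Fin n} →
               J ─ˢ I ≡ ⁅ v ⁆ → I within P → P v → J within P
slide-within {P = P} J─I I⊆P v∈P x x∈J =
  [ I⊆P x , (λ x≡v → subst P (sym x≡v) v∈P) ]′ (p─q≡⁅u⁆⇒x∈q⊎x≡u J─I x∈J)

record InducedSubgraph (G K : Graph (Fin n)) : Set where
  field
    V⇒V       : ∀ {x} → V G x → V K x
    E⇒E       : ∀ {x y} → E G x y → E K x y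
    E-reflect : ∀ {x y} → V G x → V G y → E K x y → E G x y

  -- An edge of `K` between vertices of `S` would reflect to `G`, because `S` lies in `V G`.
  sizedIndependent⁺ : ∀ {S} → IndependentOfSize k G S → IndependentOfSize k K S
  sizedIndependent⁺ (size , S⊆V , indep) =
    size , (λ u → V⇒V ∘ S⊆V u) , λ u v u∈S v∈S → indep u v u∈S v∈S ∘ E-reflect (S⊆V u u∈S) (S⊆V v v∈S)

  sizedIndependent⁻ : ∀ {S} → S within V G → IndependentOfSize k K S → IndependentOfSize k G S
  sizedIndependent⁻ S⊆V (size , _ , indep) =
    size , S⊆V , λ u v u∈S v∈S → indep u v u∈S v∈S ∘ E⇒E

  TS-edge⁺ : ∀ {I J} → E (TS k G) I J → E (TS k K) I J
  TS-edge⁺ (i , j , u , v , I─J , J─I , e) =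
    sizedIndependent⁺ i , sizedIndependent⁺ j , u , v , I─J , J─I , E⇒E e

  -- The sliding edge reflects to `G` because `u` belongs to `I` and `v` to `J`.
  TS-edge⁻ : ∀ {I J} → I within V G → J within V G → E (TS k K) I J → E (TS k G) I J
  TS-edge⁻ I⊆V J⊆V (i , j , u , v , I─J , J─I , e) =
    sizedIndependent⁻ I⊆V i , sizedIndependent⁻ J⊆V j , u , v , I─J , J─I ,
    E-reflect (I⊆V u (p─q≡⁅u⁆⇒u∈p I─J)) (J⊆V v (p─q≡⁅u⁆⇒u∈p J─I)) e

open InducedSubgraph

-- Consistency and the tokens on `V H`.

consistent-sym : (H G₁ G₂ : Graph (Fin n)) → Consistent H G₁ G₂ → Consistent H G₂ G₁
consistent-sym H G₁ G₂ (((to₁ , from₁) , (eto₁ , efrom₁)) , ((to₂ , from₂) , (eto₂ , efrom₂))) =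
  -- Besides exchanging the two halves, the membership pairs are swapped: the common vertices are
  -- now given by `V G₂ ∩ V G₁`.
  ( (to₂ ∘ Product.map₂ swap , Product.map₂ swap ∘ from₂)
  , ((λ (e , x , y) → eto₂ (e , swap x , swap y)) , λ e → Product.map₂ (Product.map swap swap) (efrom₂ e)) ) ,
  ( (to₁ ∘ Product.map₂ swap , Product.map₂ swap ∘ from₁)
  , ((λ (e , x , y) → eto₁ (e , swap x , swap y)) , λ e → Product.map₂ (Product.map swap swap) (efrom₁ e)) )

consistent-vertices : (H G₁ G₂ : Graph (Fin n)) → Consistent H G₁ G₂ → V H ≐ V G₁ ∩ V G₂
consistent-vertices H G₁ G₂ (((to , from) , _) , _) =
  (λ h → proj₂ (from h)) , (λ x → to (proj₁ x , x))

-- The edge passes through `H`: between common vertices, both graphs have exactly the edges of `H`.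
consistent-edges : (H G₁ G₂ : Graph (Fin n)) → Consistent H G₁ G₂ →
                   ∀ {x y} → V G₂ x → V G₂ y → E G₁ x y → E G₂ x y
consistent-edges H G₁ G₂ ((_ , (eto₁ , _)) , (_ , (_ , efrom₂))) x∈₂ y∈₂ e =
  proj₁ (efrom₂ (eto₁ (e , (E⇒V G₁ e , x∈₂) , (E⇒V G₁ (E-sym G₁ e) , y∈₂))))

module _ (H G₁ G₂ : Graph (Fin n)) (V≐ : V H ≐ V G₁ ∩ V G₂) where

  S₁∩S₂⊆S₁∩H : ∀ {S₁ S₂} → S₁ within V G₁ → S₂ within V G₂ → S₁ ∩ˢ S₂ ⊆ˢ S₁ ∩ˢ vertexSet H
  S₁∩S₂⊆S₁∩H {S₁} {S₂} S₁⊆V₁ S₂⊆V₂ x∈ with x∈p∩q⁻ S₁ S₂ x∈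
  ... | x∈S₁ , x∈S₂ = x∈p∩q⁺ (x∈S₁ , ∈-vertexSet⁺ H (proj₂ V≐ (S₁⊆V₁ _ x∈S₁ , S₂⊆V₂ _ x∈S₂)))

  private-token⇒∩-H : ∀ {S₁ S₂ u} → S₁ within V G₁ → S₂ within V G₂ →
                      S₁ ─ˢ S₂ ≡ ⁅ u ⁆ → ¬ V G₂ u → S₁ ∩ˢ vertexSet H ≡ S₁ ∩ˢ S₂
  private-token⇒∩-H {S₁} {S₂} S₁⊆V₁ S₂⊆V₂ S₁─S₂ u∉₂ = ⊆-antisym to (S₁∩S₂⊆S₁∩H S₁⊆V₁ S₂⊆V₂)
    where
    to : S₁ ∩ˢ vertexSet H ⊆ˢ S₁ ∩ˢ S₂
    to x∈ with x∈p∩q⁻ S₁ _ x∈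
    ... | x∈S₁ , x∈H with p─q≡⁅u⁆⇒x∈q⊎x≡u S₁─S₂ x∈S₁
    ...   | inj₁ x∈S₂ = x∈p∩q⁺ (x∈S₁ , x∈S₂)
    -- Here `x` is `u`, and membership in `V H` would put it in `V G₂`.
    ...   | inj₂ refl = contradiction (proj₂ (proj₁ V≐ (∈-vertexSet⁻ H x∈H))) u∉₂

  linked⇒private-token : ∀ S₁ S₂ → S₁ within V G₁ → S₂ within V G₂ → ∣ S₁ ∣ ≡ suc k →
                         ∣ S₁ ∩ˢ vertexSet H ∣ ≡ k → ∣ S₁ ∩ˢ S₂ ∣ ≡ k →
                         ∃ λ u → S₁ ─ˢ S₂ ≡ ⁅ u ⁆ × V G₁ u × ¬ V H u
  linked⇒private-token S₁ S₂ S₁⊆V₁ S₂⊆V₂ size ∣S₁∩H∣ ∣S₁∩S₂∣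
    with ∣p∩q∣≡k⇒p─q≡⁅x⁆ S₁ S₂ size ∣S₁∩S₂∣
  -- If `u` were in `V H`, the equality of `S₁ ∩ˢ vertexSet H` and `S₁ ∩ˢ S₂` would put it in `S₂`.
  ... | u , S₁─S₂ = u , S₁─S₂ , S₁⊆V₁ u u∈S₁ , λ u∈H →
    p─q≡⁅u⁆⇒u∉q S₁─S₂ (proj₂ (x∈p∩q⁻ S₁ S₂ (S₁∩H⊆S₁∩S₂ (x∈p∩q⁺ (u∈S₁ , ∈-vertexSet⁺ H u∈H)))))
    where
    u∈S₁ = p─q≡⁅u⁆⇒u∈p S₁─S₂

    S₁∩H⊆S₁∩S₂ : S₁ ∩ˢ vertexSet H ⊆ˢ S₁ ∩ˢ S₂
    S₁∩H⊆S₁∩S₂ = p⊆q∧∣p∣≡∣q∣⇒q⊆p (S₁∩S₂⊆S₁∩H S₁⊆V₁ S₂⊆V₂) (trans ∣S₁∩S₂∣ (sym ∣S₁∩H∣))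

-- Token sliding graphs of the join.

module _ (H G₁ G₂ : Graph (Fin n)) (c : Consistent H G₁ G₂) where

  private
    K = join H G₁ G₂ c
    c′ = consistent-sym H G₁ G₂ c
    V≐ = consistent-vertices H G₁ G₂ c
    V≐′ = consistent-vertices H G₂ G₁ c′

    -- A cross edge has an end in `V G₂` outside `V H`; were that end also in `V G₁`, it would be a
    -- common vertex and so in `V H`.
    G₁-induced : InducedSubgraph G₁ K
    G₁-induced = record
      { V⇒V = inj₁
      ; E⇒E = inj₁
      ; E-reflect = λ where
          x∈₁ y∈₁ (inj₁ e) → e
          x∈₁ y∈₁ (inj₂ (inj₁ e)) → consistent-edges H G₂ G₁ c′ x∈₁ y∈₁ e
          x∈₁ y∈₁ (inj₂ (inj₂ (inj₁ (_ , y∈₂ , y∉H)))) → contradiction (proj₂ V≐ (y∈₁ , y∈₂)) y∉H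
          x∈₁ y∈₁ (inj₂ (inj₂ (inj₂ (_ , x∈₂ , x∉H)))) → contradiction (proj₂ V≐ (x∈₁ , x∈₂)) x∉H
      }

    G₂-induced : InducedSubgraph G₂ K
    G₂-induced = record
      { V⇒V = inj₂
      ; E⇒E = inj₂ ∘ inj₁
      ; E-reflect = λ where
          x∈₂ y∈₂ (inj₁ e) → consistent-edges H G₁ G₂ c x∈₂ y∈₂ e
          x∈₂ y∈₂ (inj₂ (inj₁ e)) → e
          x∈₂ y∈₂ (inj₂ (inj₂ (inj₁ ((x∈₁ , x∉H) , _)))) → contradiction (proj₂ V≐ (x∈₁ , x∈₂)) x∉H
          x∈₂ y∈₂ (inj₂ (inj₂ (inj₂ ((y∈₁ , y∉H) , _)))) → contradiction (proj₂ V≐ (y∈₁ , y∈₂)) y∉H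
      }

  -- If some `w` in `S` is outside `V G₁`, then any `u` in `S` outside `V G₂` would be joined to `w`
  -- by a cross edge. Finiteness makes the search for `w` decidable.
  independent-one-sided : ∀ {S} → Independent K S → S within V G₁ ⊎ S within V G₂
  independent-one-sided {S} (S⊆V , indep) with any? (λ w → (w ∈? S) ×-dec ¬? (V? G₁ w))
  ... | no  ∄w = inj₁ λ u u∈S → decidable-stable (V? G₁ u) λ u∉₁ → ∄w (u , u∈S , u∉₁)
  ... | yes (w , w∈S , w∉₁) = inj₂ λ u u∈S → decidable-stable (V? G₂ u) λ u∉₂ →
    indep u w u∈S w∈S (inj₂ (inj₂ (inj₁
      ( ([ id , (λ u∈₂ → contradiction u∈₂ u∉₂) ]′ (S⊆V u u∈S) , u∉₂ ∘ proj₂ ∘ proj₁ V≐)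
      , ([ (λ w∈₁ → contradiction w∈₁ w∉₁) , id ]′ (S⊆V w w∈S) , w∉₁ ∘ proj₁ ∘ proj₁ V≐)))))

  sizedIndependent-one-sided : ∀ {S} → IndependentOfSize k K S →
                               IndependentOfSize k G₁ S ⊎ IndependentOfSize k G₂ S
  sizedIndependent-one-sided s@(_ , indep) =
    Sum.map (λ S⊆ → sizedIndependent⁻ G₁-induced S⊆ s) (λ S⊆ → sizedIndependent⁻ G₂-induced S⊆ s)
            (independent-one-sided indep)

  mixed-slide : ∀ {I J} → I within V G₁ → J within V G₂ → E (TS k K) I J →
                E (TS k G₁) I J ⊎ E (TS k G₂) I J ⊎ Linked k H G₁ G₂ I J
  mixed-slide {I = I} {J} I⊆V₁ J⊆V₂ e@(i@(∣I∣ , _) , j@(∣J∣ , _) , u , v , I─J , J─I , _)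
    with V? G₁ v | V? G₂ u
  -- When `v` lies in `V G₁`, all of `J` does, so the slide stays in `G₁`; the next case is its
  -- mirror image.
  ... | yes v∈₁ | _       = inj₁ (TS-edge⁻ G₁-induced I⊆V₁ (slide-within J─I I⊆V₁ v∈₁) e)
  ... | no  _   | yes u∈₂ = inj₂ (inj₁ (TS-edge⁻ G₂-induced (slide-within I─J J⊆V₂ u∈₂) J⊆V₂ e))
  ... | no  v∉₁ | no  u∉₂ = inj₂ (inj₂
    ( sizedIndependent⁻ G₁-induced I⊆V₁ i
    , sizedIndependent⁻ G₂-induced J⊆V₂ j
    , trans (cong ∣_∣ (private-token⇒∩-H H G₁ G₂ V≐ I⊆V₁ J⊆V₂ I─J u∉₂)) ∣I∩J∣
    , trans (cong ∣_∣ (private-token⇒∩-H H G₂ G₁ V≐′ J⊆V₂ I⊆V₁ J─I v∉₁)) ∣J∩I∣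
    , ∣I∩J∣))
    where
    ∣I∩J∣ = trans (p─q≡⁅u⁆⇒∣p∩q∣≡∣p∣∸1 I─J) (cong (_∸ 1) ∣I∣)
    ∣J∩I∣ = trans (p─q≡⁅u⁆⇒∣p∩q∣≡∣p∣∸1 J─I) (cong (_∸ 1) ∣J∣)

  TS-join-edge⁻ : ∀ {I J} → E (TS k K) I J →
                  E (TS k G₁) I J ⊎ E (TS k G₂) I J ⊎ Linked k H G₁ G₂ I J ⊎ Linked k H G₁ G₂ J I
  TS-join-edge⁻ {k = k} e@((_ , i) , (_ , j) , _)
    with independent-one-sided i | independent-one-sided j
  ... | inj₁ I⊆V₁ | inj₁ J⊆V₁ = inj₁ (TS-edge⁻ G₁-induced I⊆V₁ J⊆V₁ e)
  ... | inj₂ I⊆V₂ | inj₂ J⊆V₂ = inj₂ (inj₁ (TS-edge⁻ G₂-induced I⊆V₂ J⊆V₂ e))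
  ... | inj₁ I⊆V₁ | inj₂ J⊆V₂ = Sum.map₂ (Sum.map₂ inj₁) (mixed-slide I⊆V₁ J⊆V₂ e)
  -- The slide is reversed so that it starts in `G₁`; a link then appears as `Linked k H G₁ G₂ J I`.
  ... | inj₂ I⊆V₂ | inj₁ J⊆V₁ =
    Sum.map (E-sym (TS k G₁)) (Sum.map (E-sym (TS k G₂)) inj₂)
            (mixed-slide J⊆V₁ I⊆V₂ (E-sym (TS k K) e))

  -- With size `suc k`, the `k ∸ 1` in `Linked` computes to a plain `k`. Both private tokens are
  -- outside `V H`, so a cross edge joins them.
  linked⇒TS-join-edge : ∀ {S₁ S₂} → Linked (suc k) H G₁ G₂ S₁ S₂ → E (TS (suc k) K) S₁ S₂
  linked⇒TS-join-edge {S₁ = S₁} {S₂}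
    (s₁@(∣S₁∣ , S₁⊆V₁ , _) , s₂@(∣S₂∣ , S₂⊆V₂ , _) , ∣S₁∩H∣ , ∣S₂∩H∣ , ∣S₁∩S₂∣)
    with linked⇒private-token H G₁ G₂ V≐ S₁ S₂ S₁⊆V₁ S₂⊆V₂ ∣S₁∣ ∣S₁∩H∣ ∣S₁∩S₂∣
       | linked⇒private-token H G₂ G₁ V≐′ S₂ S₁ S₂⊆V₂ S₁⊆V₁ ∣S₂∣ ∣S₂∩H∣
           (trans (cong ∣_∣ (∩-comm S₂ S₁)) ∣S₁∩S₂∣)
  ... | u , S₁─S₂ , u∈ | v , S₂─S₁ , v∈ =
    sizedIndependent⁺ G₁-induced s₁ , sizedIndependent⁺ G₂-induced s₂ ,
    u , v , S₁─S₂ , S₂─S₁ , inj₂ (inj₂ (inj₁ (u∈ , v∈)))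

  TS-join : (2≤k : 2 ≤ k) → TS k K ≈ TS k G₁ ⊔ TS k G₂ ⊔ linkEdges k 2≤k H G₁ G₂
  -- `linkEdges` is defined by matching on `suc k` and computes only after this match; `2 ≤ k`
  -- excludes zero.
  TS-join {k = suc k} 2≤k =
    ( Sum.map₂ inj₁ ∘ sizedIndependent-one-sided
    , λ where
        (inj₁ s)        → sizedIndependent⁺ G₁-induced s
        (inj₂ (inj₁ s)) → sizedIndependent⁺ G₂-induced s
        -- Link edges bring no new vertices: `Linked` records that its ends are independent in `G₁`
        -- and `G₂`.
        (inj₂ (inj₂ (_ , inj₁ (s , _)))) → sizedIndependent⁺ G₁-induced s
        (inj₂ (inj₂ (_ , inj₂ (_ , s , _)))) → sizedIndependent⁺ G₂-induced s ) ,
    ( TS-join-edge⁻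
    , λ where
        (inj₁ e)               → TS-edge⁺ G₁-induced e
        (inj₂ (inj₁ e))        → TS-edge⁺ G₂-induced e
        (inj₂ (inj₂ (inj₁ r))) → linked⇒TS-join-edge r
        (inj₂ (inj₂ (inj₂ r))) → E-sym (TS (suc k) K) (linked⇒TS-join-edge r) )

proposition12 : ∀ (n k : ℕ) (2≤k : 2 ≤ k) (H G₁ G₂ : Graph (Fin n)) (c : Consistent H G₁ G₂) →
    TS k (join H G₁ G₂ c) ≈ TS k G₁ ⊔ TS k G₂ ⊔ linkEdges k 2≤k H G₁ G₂
proposition12 n k 2≤k H G₁ G₂ c = TS-join H G₁ G₂ c 2≤k
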